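{- Let $M$ be an $n$-counter Minsky machine and $k_1,\dots,k_n$ non-negative integers. If the sequent $$l_1\otimes r_1^{k_1}\otimes\cdots\otimes r_n^{k_n},\ !\Phi_M,\ !\mathcal{K}\ \vdash\ l_0$$ is derivable in (propositional) linear logic, then $M$ can go from the initial configuration $(L_1,k_1,\dots,k_n)$ to the halting configuration $(L_0,0,\dots,0)$.
   Context: An $n$-counter Minsky machine $M$ has counters $x_1,\dots,x_n$ with non-negative integer values and a finite list of instructions labelled by labels $L_0,L_1,\dots$, each of one of the forms: (1) $L_i: x_m:=x_m+1$; goto $L_j$; (2) $L_i: x_m:=x_m-1$; goto $L_j$; (3) $L_i$: if $x_m>0$ then goto $L_j$; (4) $L_i$: if $x_m=0$ then goto $L_j$; (5) $L_0$: halt; where $i\ge1$. A configuration is $(L,c_1,\dots,c_n)$; a computation is a finite sequence of configurations each obtained from the previous by applying an instruction of $M$ (an instruction at $L_i$ applies only in a configuration with label $L_i$; type (2) requires $x_m\ge1$, type (3) requires $x_m>0$, type (4) requires $x_m=0$). Encoding: distinct propositional literals $r_1,\dots,r_n$, $l_0,l_1,\dots$ (one per label), $\kappa_1,\dots,\kappa_n$; $r^k$ is the tensor of $k$ copies of $r$ (omitted when $k=0$). For an instruction $I$ of type (1)–(4): $\varphi_{(1)}=l_i\multimap(l_j\otimes r_m)$, $\varphi_{(2)}=(l_i\otimes r_m)\multimap l_j$, $\varphi_{(3)}=(l_i\otimes r_m)\multimap(l_j\otimes r_m)$, $\varphi_{(4)}=l_i\multimap(l_j\oplus\kappa_m)$.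 $\Phi_M$ is the multiset of $\varphi_I$ over the instructions of $M$ of types (1)–(4). $\mathcal{K}=\bigcup_{m=1}^n\mathcal{K}_m$, where $\mathcal{K}_m$ consists of $\kappa_m\multimap l_0$ and $(\kappa_m\otimes r_i)\multimap\kappa_m$ for every $i\ne m$. $!\Phi$ denotes $\{!A: A\in\Phi\}$. -}

module Defs where

open import Data.Fin using (Fin; _≟_)
open import Data.List using (List; []; _∷_; [_]; _++_; map; concatMap; filter; foldl; allFin)
open import Data.List.Membership.Propositional using (_∈_)
open import Data.List.Relation.Binary.Permutation.Propositional using (_↭_)
open import Data.Nat using (ℕ; zero; suc; pred; _≥_; _>_; NonZero)
open import Data.Product using (_×_; _,_; ∃-syntax)
open import Data.Vec using (Vec; lookup; updateAt; replicate)
open import Relation.Binary.Construct.Closure.ReflexiveTransitive using (Star)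
open import Relation.Binary.PropositionalEquality using (_≡_)
open import Relation.Nullary.Decidable using (¬?)

-- i stands for Lᵢ.
Label : Set
Label = ℕ

-- A label may carry several instructions, so machines may be
-- nondeterministic. Only halt can be labelled L₀.
data Instruction (n : ℕ) : Set where
  inc    : (i : Label) .{{_ : NonZero i}} (m : Fin n) (j : Label) → Instruction n
  dec    : (i : Label) .{{_ : NonZero i}} (m : Fin n) (j : Label) → Instruction n
  ifPos  : (i : Label) .{{_ : NonZero i}} (m : Fin n) (j : Label) → Instruction n
  ifZero : (i : Label) .{{_ : NonZero i}} (m : Fin n) (j : Label) → Instruction n
  halt   : Instruction n

Machine : ℕ → Set
Machine n = List (Instruction n)

Config : ℕ → Set
Config n = Label × Vec ℕ n

data Apply {n : ℕ} : Instruction n → Config n → Config n → Set where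
  inc    : ∀ {i m j c} .{{_ : NonZero i}} →
           Apply (inc i m j) (i , c) (j , updateAt c m suc)
  dec    : ∀ {i m j c} .{{_ : NonZero i}} → lookup c m ≥ 1 →
           Apply (dec i m j) (i , c) (j , updateAt c m pred)
  ifPos  : ∀ {i m j c} .{{_ : NonZero i}} → lookup c m > 0 →
           Apply (ifPos i m j) (i , c) (j , c)
  ifZero : ∀ {i m j c} .{{_ : NonZero i}} → lookup c m ≡ 0 →
           Apply (ifZero i m j) (i , c) (j , c)

Step : ∀ {n} → Machine n → Config n → Config n → Set
Step M s t = ∃[ I ] (I ∈ M × Apply I s t)

CanGo : ∀ {n} → Machine n → Config n → Config n → Set
CanGo M = Star (Step M)

initial : ∀ {n} → Vec ℕ n → Config n
initial k = 1 , k

halting : ∀ {n} → Config n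
halting {n} = 0 , replicate n 0

infix  9 !_ ¿_
infix  10 _^⊥
infixl 7 _⊗_ _⅋_
infixl 6 _&_ _⊕_
infixr 5 _⊸_
infix  3 _⊢_

-- ¿ stands for the exponential "why not", since ? is reserved by Agda.
data Formula (A : Set) : Set where
  atom                : A → Formula A
  𝟏 ⊥ ⊤ 𝟎             : Formula A
  _^⊥ !_ ¿_           : Formula A → Formula A
  _⊗_ _⅋_ _&_ _⊕_ _⊸_ : Formula A → Formula A → Formula A

private variable
  A            : Set
  B C          : Formula A
  Γ Γ′ Δ Δ′    : List (Formula A)

-- Both sides of a sequent are multisets: lists up to exchange.
data _⊢_ {A : Set} : List (Formula A) → List (Formula A) → Set where
  ax   : [ B ] ⊢ [ B ]
  cut  : Γ ⊢ B ∷ Δ → B ∷ Γ′ ⊢ Δ′ → Γ ++ Γ′ ⊢ Δ ++ Δ′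
  exch : Γ ↭ Γ′ → Δ ↭ Δ′ → Γ ⊢ Δ → Γ′ ⊢ Δ′

  ^⊥L  : Γ ⊢ B ∷ Δ → B ^⊥ ∷ Γ ⊢ Δ
  ^⊥R  : B ∷ Γ ⊢ Δ → Γ ⊢ B ^⊥ ∷ Δ

  𝟏L   : Γ ⊢ Δ → 𝟏 ∷ Γ ⊢ Δ
  𝟏R   : [] ⊢ [ 𝟏 ]
  ⊥L   : [ ⊥ ] ⊢ []
  ⊥R   : Γ ⊢ Δ → Γ ⊢ ⊥ ∷ Δ
  ⊤R   : Γ ⊢ ⊤ ∷ Δ
  𝟎L   : 𝟎 ∷ Γ ⊢ Δ

  ⊗L   : B ∷ C ∷ Γ ⊢ Δ → B ⊗ C ∷ Γ ⊢ Δ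
  ⊗R   : Γ ⊢ B ∷ Δ → Γ′ ⊢ C ∷ Δ′ → Γ ++ Γ′ ⊢ B ⊗ C ∷ Δ ++ Δ′
  ⅋L   : B ∷ Γ ⊢ Δ → C ∷ Γ′ ⊢ Δ′ → B ⅋ C ∷ Γ ++ Γ′ ⊢ Δ ++ Δ′
  ⅋R   : Γ ⊢ B ∷ C ∷ Δ → Γ ⊢ B ⅋ C ∷ Δ
  ⊸L   : Γ ⊢ B ∷ Δ → C ∷ Γ′ ⊢ Δ′ → (B ⊸ C) ∷ Γ ++ Γ′ ⊢ Δ ++ Δ′
  ⊸R   : B ∷ Γ ⊢ C ∷ Δ → Γ ⊢ (B ⊸ C) ∷ Δ

  &L₁  : B ∷ Γ ⊢ Δ → B & C ∷ Γ ⊢ Δ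
  &L₂  : C ∷ Γ ⊢ Δ → B & C ∷ Γ ⊢ Δ
  &R   : Γ ⊢ B ∷ Δ → Γ ⊢ C ∷ Δ → Γ ⊢ B & C ∷ Δ
  ⊕L   : B ∷ Γ ⊢ Δ → C ∷ Γ ⊢ Δ → B ⊕ C ∷ Γ ⊢ Δ
  ⊕R₁  : Γ ⊢ B ∷ Δ → Γ ⊢ B ⊕ C ∷ Δ
  ⊕R₂  : Γ ⊢ C ∷ Δ → Γ ⊢ B ⊕ C ∷ Δ

  !W   : Γ ⊢ Δ → ! B ∷ Γ ⊢ Δ
  !C   : ! B ∷ ! B ∷ Γ ⊢ Δ → ! B ∷ Γ ⊢ Δ
  !D   : B ∷ Γ ⊢ Δ → ! B ∷ Γ ⊢ Δ
  !R   : map !_ Γ ⊢ B ∷ map ¿_ Δ → map !_ Γ ⊢ ! B ∷ map ¿_ Δ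
  ¿W   : Γ ⊢ Δ → Γ ⊢ ¿ B ∷ Δ
  ¿C   : Γ ⊢ ¿ B ∷ ¿ B ∷ Δ → Γ ⊢ ¿ B ∷ Δ
  ¿D   : Γ ⊢ B ∷ Δ → Γ ⊢ ¿ B ∷ Δ
  ¿L   : B ∷ map !_ Γ ⊢ map ¿_ Δ → ¿ B ∷ map !_ Γ ⊢ map ¿_ Δ

-- pow⁺ B k is the tensor of k + 1 copies of B.
pow⁺ : Formula A → ℕ → Formula A
pow⁺ B zero    = B
pow⁺ B (suc k) = pow⁺ B k ⊗ B

-- C ⊗ Bᵏ, where the factor Bᵏ is omitted when k = 0.
_⊗[_^_] : Formula A → Formula A → ℕ → Formula A
C ⊗[ B ^ zero  ] = C
C ⊗[ B ^ suc k ] = C ⊗ pow⁺ B k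

data Literal (n : ℕ) : Set where
  `r : Fin n → Literal n
  `l : Label → Literal n
  `κ : Fin n → Literal n

-- ν assigns atoms to the literals of the encoding; these atoms are
-- distinct when ν is injective, and there may be others.
module Encoding {n : ℕ} {A : Set} (ν : Literal n → A) where

  r : Fin n → Formula A
  r m = atom (ν (`r m))

  l : Label → Formula A
  l i = atom (ν (`l i))

  κ : Fin n → Formula A
  κ m = atom (ν (`κ m))

  φ : Instruction n → List (Formula A)
  φ (inc i m j)    = [ l i ⊸ (l j ⊗ r m) ]
  φ (dec i m j)    = [ (l i ⊗ r m) ⊸ l j ]
  φ (ifPos i m j)  = [ (l i ⊗ r m) ⊸ (l j ⊗ r m) ]
  φ (ifZero i m j) = [ l i ⊸ (l j ⊕ κ m) ]
  φ halt           = []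

  Φ : Machine n → List (Formula A)
  Φ = concatMap φ

  𝒦ₘ : Fin n → List (Formula A)
  𝒦ₘ m = (κ m ⊸ l 0) ∷
         map (λ i → (κ m ⊗ r i) ⊸ κ m) (filter (λ i → ¬? (i ≟ m)) (allFin n))

  𝒦 : List (Formula A)
  𝒦 = concatMap 𝒦ₘ (allFin n)

  -- l₁ ⊗ r₁^k₁ ⊗ ⋯ ⊗ rₙ^kₙ
  start : Vec ℕ n → Formula A
  start k = foldl (λ C m → C ⊗[ r m ^ lookup k m ]) (l 1) (allFin n)

{-# OPTIONS --safe #-}
module Submission where

-- Phase semantics, which is sound for derivations with cut. In the commutative
-- monoid of multisets of control tokens paired with vectors of counters, the
-- pole consists of the configurations (Lᵢ , c) from which (L₀ , 0) is reachable
-- and of the zero tests (κₘ , c) with cₘ = 0. Every formula of Φ_M and 𝒦 then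
-- holds at the unit, so a derivation of the sequent puts l₁ r₁^k₁ ⋯ rₙ^kₙ in the
-- interpretation of l₀, which is contained in the pole because the pole
-- contains l₀ itself.

open import Defs
open import Algebra.Bundles using (CommutativeMonoid)
import Algebra.Construct.DirectProduct as DirectProduct
import Algebra.Solver.CommutativeMonoid as Solver
open import Data.Empty using () renaming (⊥ to Empty)
open import Data.Fin using (Fin; zero; suc; _≟_)
open import Data.List using (List; []; _∷_; [_]; _++_; map; foldl; allFin; tabulate)
open import Data.List.Membership.Propositional using (_∈_)
open import Data.List.Properties using (map-++; map-tabulate)
open import Data.List.Relation.Binary.Permutation.Propositional as Perm using (_↭_)
open import Data.List.Relation.Unary.All as All using (All; []; _∷_)
import Data.List.Relation.Unary.All.Properties as All
open import Data.Nat using (ℕ; zero; suc; pred; _+_; _>_; z≤n; s≤s)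
open import Data.Nat.Properties using (+-assoc; +-comm; +-suc; +-identityˡ; +-identityʳ)
open import Data.Product using (_×_; _,_; ∃-syntax)
open import Data.Sum using (inj₁; inj₂)
open import Data.Vec using (Vec; []; _∷_; lookup; updateAt; replicate; zipWith)
open import Data.Vec.Properties
  using (zipWith-assoc; zipWith-comm; zipWith-identityˡ; zipWith-identityʳ;
         lookup-replicate; lookup∘updateAt; lookup∘updateAt′; updateAt-updateAt;
         updateAt-id; updateAt-cong)
open import Function using (_∘_)
open import Function.Definitions using (Injective)
open import Level using (0ℓ)
open import Relation.Binary.Construct.Closure.ReflexiveTransitive as Star using (_◅_)
open import Relation.Binary.PropositionalEquality
  using (_≡_; _≢_; refl; sym; trans; cong; cong₂; subst; isEquivalence;
         module ≡-Reasoning)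
open import Relation.Nullary.Decidable using (¬?)
open import Relation.Unary using (Pred; _⊆_; _∪_; _∩_; ∅; ｛_｝)

-- Phase semantics

module PhaseSemantics
  {c ℓ} (𝑴 : CommutativeMonoid c ℓ)
  (Pole : Pred (CommutativeMonoid.Carrier 𝑴) c)
  (resp : ∀ {x y} → CommutativeMonoid._≈_ 𝑴 x y → Pole x → Pole y)
  {A : Set} (v : A → Pred (CommutativeMonoid.Carrier 𝑴) c) where

  open CommutativeMonoid 𝑴 renaming (refl to ≈-refl; sym to ≈-sym; trans to ≈-trans)
  open Solver 𝑴 using (solve; _⊜_) renaming (_⊕_ to _·_)

  infix  9 _ᗮ
  infixr 7 _⊙_

  _ᗮ : ∀ {p} → Pred Carrier p → Pred Carrier _
  (X ᗮ) y = ∀ x → X x → Pole (x ∙ y)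

  data _⊙_ (X Y : Pred Carrier c) : Pred Carrier c where
    _,_ : ∀ {x y} → X x → Y y → (X ⊙ Y) (x ∙ y)

  -- ⟦ B ⟧ᶜ is a set of refutations of B: the fact ⟦ B ⟧ is its orthogonal, so
  -- facts are closed under ᗮᗮ by construction.
  mutual
    ⟦_⟧ : Formula A → Pred Carrier c
    ⟦ B ⟧ = ⟦ B ⟧ᶜ ᗮ

    ⟦_⟧ᶜ : Formula A → Pred Carrier c
    ⟦ atom a ⟧ᶜ = v a ᗮ
    ⟦ 𝟏 ⟧ᶜ      = ｛ ε ｝ ᗮ
    ⟦ ⊥ ⟧ᶜ      = ｛ ε ｝
    ⟦ ⊤ ⟧ᶜ      = ∅ ᗮ ᗮ
    ⟦ 𝟎 ⟧ᶜ      = ∅ ᗮ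
    ⟦ B ^⊥ ⟧ᶜ   = ⟦ B ⟧
    ⟦ ! B ⟧ᶜ    = (⟦ B ⟧ ∩ ｛ ε ｝) ᗮ
    ⟦ ¿ B ⟧ᶜ    = ⟦ B ⟧ ᗮ ∩ ｛ ε ｝
    ⟦ B ⊗ C ⟧ᶜ  = (⟦ B ⟧ ⊙ ⟦ C ⟧) ᗮ
    ⟦ B ⅋ C ⟧ᶜ  = ⟦ B ⟧ᶜ ⊙ ⟦ C ⟧ᶜ
    ⟦ B & C ⟧ᶜ  = ⟦ B ⟧ᶜ ∪ ⟦ C ⟧ᶜ
    ⟦ B ⊕ C ⟧ᶜ  = (⟦ B ⟧ ∪ ⟦ C ⟧) ᗮ
    ⟦ B ⊸ C ⟧ᶜ  = ⟦ B ⟧ ⊙ ⟦ C ⟧ᶜ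

  private variable
    B C         : Formula A
    Γ Γ′ Δ Δ′   : List (Formula A)
    f           : Formula A → Pred Carrier c
    u x y z     : Carrier

  -- Contexts and validity of sequents

  ⟦⟧-resp : ∀ B → x ≈ y → ⟦ B ⟧ x → ⟦ B ⟧ y
  ⟦⟧-resp B x≈y b u t = resp (∙-congˡ x≈y) (b u t)

  data ⨂ (f : Formula A → Pred Carrier c) : List (Formula A) → Pred Carrier c where
    []  : ⨂ f [] ε
    _∷_ : f B x → ⨂ f Γ y → ⨂ f (B ∷ Γ) (x ∙ y)

  ⨂-split : ∀ Γ → ⨂ f (Γ ++ Γ′) x → ∃[ y ] ∃[ z ] (⨂ f Γ y × ⨂ f Γ′ z × y ∙ z ≈ x)
  ⨂-split []      γ = _ , _ , [] , γ , identityˡ _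
  ⨂-split (B ∷ Γ) (b ∷ γ) with ⨂-split Γ γ
  ... | _ , _ , γ₁ , γ₂ , eq = _ , _ , b ∷ γ₁ , γ₂ , ≈-trans (assoc _ _ _) (∙-congˡ eq)

  ⨂-resp-↭ : Γ ↭ Γ′ → ⨂ f Γ′ x → ∃[ y ] (⨂ f Γ y × y ≈ x)
  ⨂-resp-↭ Perm.refl γ = _ , γ , ≈-refl
  ⨂-resp-↭ (Perm.prep _ p) (b ∷ γ) with ⨂-resp-↭ p γ
  ... | _ , γ′ , eq = _ , b ∷ γ′ , ∙-congˡ eq
  ⨂-resp-↭ (Perm.swap _ _ p) (b ∷ c ∷ γ) with ⨂-resp-↭ p γ
  ... | _ , γ′ , eq = _ , c ∷ b ∷ γ′ ,
    ≈-trans (∙-congˡ (∙-congˡ eq)) (solve 3 (λ b c x → c · (b · x) ⊜ b · (c · x)) ≈-refl _ _ _)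
  ⨂-resp-↭ (Perm.trans p q) γ with ⨂-resp-↭ q γ
  ... | _ , γ′ , eq with ⨂-resp-↭ p γ′
  ... | _ , γ″ , eq′ = _ , γ″ , ≈-trans eq′ eq

  -- Formulas on the right enter through their refutations, so a two-sided sequent becomes a single
  -- product that must land in the pole.
  Valid : List (Formula A) → List (Formula A) → Set _
  Valid Γ Δ = ∀ {x y} → ⨂ ⟦_⟧ Γ x → ⨂ ⟦_⟧ᶜ Δ y → Pole (x ∙ y)

  elimʳ : Valid Γ (B ∷ Δ) → ⨂ ⟦_⟧ Γ x → ⨂ ⟦_⟧ᶜ Δ y → ⟦ B ⟧ (x ∙ y)
  elimʳ d γ δ _ t =
    resp (solve 3 (λ x t y → x · (t · y) ⊜ t · (x · y)) ≈-refl _ _ _) (d γ (t ∷ δ))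

  -- The result lies in `⟦ B ⟧ ᗮ` rather than `⟦ B ⟧ᶜ`, because a set of refutations need not be
  -- closed under double orthogonals.
  elimˡ : Valid (B ∷ Γ) Δ → ⨂ ⟦_⟧ Γ x → ⨂ ⟦_⟧ᶜ Δ y → (⟦ B ⟧ ᗮ) (x ∙ y)
  elimˡ d γ δ _ b = resp (assoc _ _ _) (d (b ∷ γ) δ)

  introʳ : (∀ {u x y} → ⟦ B ⟧ᶜ u → ⨂ ⟦_⟧ Γ x → ⨂ ⟦_⟧ᶜ Δ y → Pole ((x ∙ y) ∙ u)) →
           Valid Γ (B ∷ Δ)
  introʳ d γ (t ∷ δ) =
    resp (solve 3 (λ x t y → (x · y) · t ⊜ x · (t · y)) ≈-refl _ _ _) (d t γ δ)

  introˡ : (∀ {u x y} → ⟦ B ⟧ u → ⨂ ⟦_⟧ Γ x → ⨂ ⟦_⟧ᶜ Δ y → Pole ((x ∙ y) ∙ u)) →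
           Valid (B ∷ Γ) Δ
  introˡ d (b ∷ γ) δ =
    resp (solve 3 (λ x b y → (x · y) · b ⊜ (b · x) · y) ≈-refl _ _ _) (d b γ δ)

  -- A sequent groups its contexts by side, a two-premise rule by premise. This regroups the product
  -- and keeps `u` free for the principal formula.
  merge : (∀ {x y x′ y′} → ⨂ ⟦_⟧ Γ x → ⨂ ⟦_⟧ᶜ Δ y → ⨂ ⟦_⟧ Γ′ x′ → ⨂ ⟦_⟧ᶜ Δ′ y′ →
             Pole (((x ∙ y) ∙ (x′ ∙ y′)) ∙ u)) →
          ⨂ ⟦_⟧ (Γ ++ Γ′) x → ⨂ ⟦_⟧ᶜ (Δ ++ Δ′) y → Pole ((x ∙ y) ∙ u)
  merge {Γ = Γ} {Δ = Δ} d γ δ with ⨂-split Γ γ | ⨂-split Δ δ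
  ... | _ , _ , γ₁ , γ₂ , eq | _ , _ , δ₁ , δ₂ , eq′ =
    resp (≈-trans (solve 5 (λ x y x′ y′ u → ((x · y) · (x′ · y′)) · u ⊜ ((x · x′) · (y · y′)) · u)
                    ≈-refl _ _ _ _ _)
                  (∙-congʳ (∙-cong eq eq′)))
         (d γ₁ δ₁ γ₂ δ₂)

  -- Exponentials

  !-unit : ∀ B → ⟦ B ⟧ ε → ⟦ ! B ⟧ ε
  !-unit B p _ t = resp (comm _ _) (t _ (p , refl))

  !-refute : ∀ B → (⟦ B ⟧ ε → Pole z) → ⟦ ! B ⟧ᶜ z
  !-refute B k _ (p , refl) = resp (≈-sym (identityˡ _)) (k p)

  -- An element of ⟦ ! B ⟧ may be replaced by the unit inside the pole, so the
  -- premise of a promotion only has to be used at the unit.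
  !-context : ∀ Γ → (∀ {x} → x ≈ ε → ⨂ ⟦_⟧ (map !_ Γ) x → Pole u) →
              ⨂ ⟦_⟧ (map !_ Γ) x → Pole (x ∙ u)
  !-context []      k []      = resp (≈-sym (identityˡ _)) (k ≈-refl [])
  !-context (B ∷ Γ) k (b ∷ γ) =
    resp (solve 3 (λ b x u → (x · u) · b ⊜ (b · x) · u) ≈-refl _ _ _)
      (b _ (!-refute B λ p → !-context Γ
        (λ eq γ′ → k (≈-trans (identityˡ _) eq) (!-unit B p ∷ γ′)) γ))

  ¿-context : ∀ Δ → ⨂ ⟦_⟧ᶜ (map ¿_ Δ) y → y ≈ ε
  ¿-context []      []               = ≈-refl
  ¿-context (B ∷ Δ) ((_ , refl) ∷ δ) = ≈-trans (identityˡ _) (¿-context Δ δ)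

  -- Both contexts collapse to the unit, which is where the promoted formula has to be proved or
  -- refuted.
  promote : ∀ Γ Δ →
            (∀ {x y} → x ∙ y ≈ ε → ⨂ ⟦_⟧ (map !_ Γ) x → ⨂ ⟦_⟧ᶜ (map ¿_ Δ) y → Pole u) →
            ⨂ ⟦_⟧ (map !_ Γ) x → ⨂ ⟦_⟧ᶜ (map ¿_ Δ) y → Pole ((x ∙ y) ∙ u)
  promote Γ Δ k γ δ =
    resp (∙-congʳ (≈-trans (≈-sym (identityʳ _)) (∙-congˡ (≈-sym (¿-context Δ δ)))))
      (!-context Γ (λ eq γ′ → k (≈-trans (∙-cong eq (¿-context Δ δ)) (identityˡ _)) γ′ δ) γ)

  -- Soundness

  sound : Γ ⊢ Δ → Valid Γ Δ
  sound ax (b ∷ []) (t ∷ []) =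
    resp (≈-trans (comm _ _) (≈-sym (∙-cong (identityʳ _) (identityʳ _)))) (b _ t)
  -- One premise yields a member of `⟦ B ⟧`, the other an element orthogonal to all of `⟦ B ⟧`. The
  -- spare factor of `merge` is filled by the unit.
  sound (cut d e) γ δ = resp (identityʳ _) (merge (λ γ δ γ′ δ′ →
    resp (≈-sym (identityʳ _)) (elimˡ (sound e) γ′ δ′ _ (elimʳ (sound d) γ δ))) γ δ)
  sound (exch p q d) γ δ with ⨂-resp-↭ p γ | ⨂-resp-↭ q δ
  ... | _ , γ′ , eq | _ , δ′ , eq′ = resp (∙-cong eq eq′) (sound d γ′ δ′)
  sound (^⊥L d) = introˡ λ b γ δ → b _ (elimʳ (sound d) γ δ)
  sound (^⊥R d) = introʳ λ b γ δ → resp (comm _ _) (elimˡ (sound d) γ δ _ b)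
  sound (𝟏L d)  = introˡ λ b γ δ → b _ λ { _ refl → resp (≈-sym (identityˡ _)) (sound d γ δ) }
  sound 𝟏R [] (t ∷ []) = resp (∙-congˡ (≈-sym (identityʳ _))) (t _ refl)
  sound ⊥L (b ∷ []) [] = resp (≈-trans (comm _ _) (≈-sym (identityʳ _))) (b _ refl)
  sound (⊥R d)  = introʳ λ { refl γ δ → resp (≈-sym (identityʳ _)) (sound d γ δ) }
  sound ⊤R      = introʳ λ t _ _ → t _ λ _ ()
  sound 𝟎L      = introˡ λ b _ _ → b _ λ _ ()
  sound (⊗L d)  = introˡ λ b γ δ → b _ λ { _ (b₁ , b₂) →
    resp (solve 4 (λ b₁ b₂ x y → (b₁ · (b₂ · x)) · y ⊜ (b₁ · b₂) · (x · y)) ≈-refl _ _ _ _)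
      (sound d (b₁ ∷ b₂ ∷ γ) δ) }
  sound (⊗R d e) = introʳ λ t → merge λ γ δ γ′ δ′ →
    t _ (elimʳ (sound d) γ δ , elimʳ (sound e) γ′ δ′)
  -- Each premise accepts only members of its fact, so membership is tested against refutations `t`
  -- and `t′` in turn. Together they refute `B ⅋ C`, and `b` applies.
  sound (⅋L d e) = introˡ λ b → merge λ γ δ γ′ δ′ →
    resp (solve 3 (λ z z′ u → (u · z′) · z ⊜ (z · z′) · u) ≈-refl _ _ _)
      (elimˡ (sound d) γ δ _ λ _ t →
        resp (assoc _ _ _)
          (elimˡ (sound e) γ′ δ′ _ λ _ t′ →
            resp (solve 3 (λ t t′ u → (t · t′) · u ⊜ t′ · (t · u)) ≈-refl _ _ _)
              (b _ (t , t′))))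
  sound (⅋R d)  = introʳ λ { (t₁ , t₂) γ δ →
    resp (solve 4 (λ x y t₁ t₂ → x · (t₁ · (t₂ · y)) ⊜ (x · y) · (t₁ · t₂)) ≈-refl _ _ _ _)
      (sound d γ (t₁ ∷ t₂ ∷ δ)) }
  sound (⊸L d e) = introˡ λ b → merge λ γ δ γ′ δ′ →
    resp (solve 3 (λ z z′ u → (z · u) · z′ ⊜ (z · z′) · u) ≈-refl _ _ _)
      (elimˡ (sound e) γ′ δ′ _ λ _ t →
        resp (solve 3 (λ z t u → (z · t) · u ⊜ t · (z · u)) ≈-refl _ _ _)
          (b _ (elimʳ (sound d) γ δ , t)))
  sound (⊸R d)  = introʳ λ { (b , t) γ δ →
    resp (solve 4 (λ x y b t → (b · x) · (t · y) ⊜ (x · y) · (b · t)) ≈-refl _ _ _ _)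
      (sound d (b ∷ γ) (t ∷ δ)) }
  sound (&L₁ d)  = introˡ λ b γ δ → resp (comm _ _) (elimˡ (sound d) γ δ _ λ _ → b _ ∘ inj₁)
  sound (&L₂ d)  = introˡ λ b γ δ → resp (comm _ _) (elimˡ (sound d) γ δ _ λ _ → b _ ∘ inj₂)
  sound (&R d e) = introʳ λ
    { (inj₁ t) γ δ → resp (comm _ _) (elimʳ (sound d) γ δ _ t)
    ; (inj₂ t) γ δ → resp (comm _ _) (elimʳ (sound e) γ δ _ t) }
  sound (⊕L d e) = introˡ λ b γ δ → b _ λ
    { _ (inj₁ p) → elimˡ (sound d) γ δ _ p
    ; _ (inj₂ p) → elimˡ (sound e) γ δ _ p }
  sound (⊕R₁ d)  = introʳ λ t γ δ → t _ (inj₁ (elimʳ (sound d) γ δ))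
  sound (⊕R₂ d)  = introʳ λ t γ δ → t _ (inj₂ (elimʳ (sound d) γ δ))
  sound (!W {B = B} d) = introˡ λ b γ δ → b _ (!-refute B λ _ → sound d γ δ)
  sound (!C {B = B} d) = introˡ λ b γ δ → b _ (!-refute B λ p →
    resp (∙-congʳ (≈-trans (identityˡ _) (identityˡ _)))
      (sound d (!-unit B p ∷ !-unit B p ∷ γ) δ))
  sound (!D d)   = introˡ λ b γ δ → b _ λ { _ (p , refl) → elimˡ (sound d) γ δ _ p }
  sound (!R {Γ = Γ} {B = B} {Δ = Δ} d) = introʳ λ t → promote Γ Δ λ eq γ δ →
    resp (identityˡ _) (t _ (⟦⟧-resp B eq (elimʳ (sound d) γ δ) , refl))
  sound (¿W d)   = introʳ λ { (_ , refl) γ δ → resp (≈-sym (identityʳ _)) (sound d γ δ) }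
  sound (¿C d)   = introʳ λ { (t , refl) γ δ →
    resp (≈-trans (∙-congˡ (≈-trans (identityˡ _) (identityˡ _))) (≈-sym (identityʳ _)))
      (sound d γ ((t , refl) ∷ (t , refl) ∷ δ)) }
  sound (¿D d)   = introʳ λ { (t , refl) γ δ → t _ (elimʳ (sound d) γ δ) }
  sound (¿L {Γ = Γ} {Δ = Δ} d) = introˡ λ b → promote Γ Δ λ eq γ δ →
    resp (identityˡ _) (b _ ((λ _ p → resp (∙-congˡ eq) (elimˡ (sound d) γ δ _ p)) , refl))

  -- Formulas true at the unit

  ⨂-! : All (λ B → ⟦ B ⟧ ε) Γ → ∃[ x ] (⨂ ⟦_⟧ (map !_ Γ) x × x ≈ ε)
  ⨂-! []                = _ , [] , ≈-refl
  ⨂-! (_∷_ {x = B} p ps) with ⨂-! ps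
  ... | _ , γ , eq = _ , !-unit B p ∷ γ , ≈-trans (identityˡ _) eq

  -- Hypotheses under `!` that hold at the unit contribute only the unit to the product, so they
  -- vanish from the soundness statement.
  ⊢⇒⟦⟧-⊆ : All (λ B → ⟦ B ⟧ ε) Γ → B ∷ map !_ Γ ⊢ [ C ] → ⟦ B ⟧ ⊆ ⟦ C ⟧
  ⊢⇒⟦⟧-⊆ ps d b t u with ⨂-! ps
  ... | _ , γ , eq = resp
    (≈-trans (∙-cong (≈-trans (∙-congˡ eq) (identityʳ _)) (identityʳ _)) (comm _ _))
    (sound d (b ∷ γ) (u ∷ []))

  -- With one factor fixed, orthogonality to the generators of the other extends to their closure.
  -- As `⟦ atom a ⟧` is `v a ᗮ ᗮ`, a tensor of atoms can be refuted on generators alone.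
  ⊙-ᗮᗮ : ∀ {X Y} → (X ⊙ Y) ᗮ ⊆ (X ᗮ ᗮ ⊙ Y ᗮ ᗮ) ᗮ
  ⊙-ᗮᗮ t _ (b , c) =
    resp (solve 3 (λ x y z → (x · z) · y ⊜ (x · y) · z) ≈-refl _ _ _)
      (c _ λ _ q → resp (solve 3 (λ x y z → (y · z) · x ⊜ y · (x · z)) ≈-refl _ _ _)
        (b _ λ _ p → resp (assoc _ _ _) (t _ (p , q))))

  ⊗-affirm : ∀ B C → ⟦ B ⟧ x → ⟦ C ⟧ y → ⟦ B ⊗ C ⟧ (x ∙ y)
  ⊗-affirm B C b c _ t = resp (comm _ _) (t _ (b , c))

  -- Orthogonality is antitone. For an instruction this reads backwards: whatever completes the
  -- target to a halting run also completes the source.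
  ⊸-affirm : ∀ B C → ⟦ C ⟧ᶜ ⊆ ⟦ B ⟧ᶜ → ⟦ B ⊸ C ⟧ ε
  ⊸-affirm B C C⊆B _ (b , t) =
    resp (≈-trans (comm _ _) (≈-sym (identityʳ _))) (b _ (C⊆B t))

-- Multisets of two or more tokens need not be told apart: all lie outside the pole.
data AtMostOne (S : Set) : Set where
  none : AtMostOne S
  one  : S → AtMostOne S
  many : AtMostOne S

module _ {S : Set} where

  _∪ₜ_ : AtMostOne S → AtMostOne S → AtMostOne S
  none  ∪ₜ t     = t
  one s ∪ₜ none  = one s
  one _ ∪ₜ one _ = many
  one _ ∪ₜ many  = many
  many  ∪ₜ _     = many

  ∪ₜ-identityʳ : ∀ t → t ∪ₜ none ≡ t
  ∪ₜ-identityʳ none    = refl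
  ∪ₜ-identityʳ (one _) = refl
  ∪ₜ-identityʳ many    = refl

  ∪ₜ-comm : ∀ s t → s ∪ₜ t ≡ t ∪ₜ s
  ∪ₜ-comm none    t       = sym (∪ₜ-identityʳ t)
  ∪ₜ-comm (one _) none    = refl
  ∪ₜ-comm (one _) (one _) = refl
  ∪ₜ-comm (one _) many    = refl
  ∪ₜ-comm many    none    = refl
  ∪ₜ-comm many    (one _) = refl
  ∪ₜ-comm many    many    = refl

  ∪ₜ-assoc : ∀ s t u → (s ∪ₜ t) ∪ₜ u ≡ s ∪ₜ (t ∪ₜ u)
  ∪ₜ-assoc none    _       _       = refl
  ∪ₜ-assoc (one _) none    _       = refl
  ∪ₜ-assoc (one _) (one _) none    = refl
  ∪ₜ-assoc (one _) (one _) (one _) = refl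
  ∪ₜ-assoc (one _) (one _) many    = refl
  ∪ₜ-assoc (one _) many    _       = refl
  ∪ₜ-assoc many    _       _       = refl

AtMostOne-commutativeMonoid : Set → CommutativeMonoid 0ℓ 0ℓ
AtMostOne-commutativeMonoid S = record
  { _∙_ = _∪ₜ_ {S}
  ; ε   = none
  ; isCommutativeMonoid = record
    { isMonoid = record
      { isSemigroup = record
        { isMagma = record { isEquivalence = isEquivalence ; ∙-cong = cong₂ _∪ₜ_ }
        ; assoc   = ∪ₜ-assoc
        }
      ; identity = (λ _ → refl) , ∪ₜ-identityʳ
      }
    ; comm = ∪ₜ-comm
    }
  }

-- Vectors of counters

infixl 6 _+ᵛ_

_+ᵛ_ : ∀ {n} → Vec ℕ n → Vec ℕ n → Vec ℕ n
_+ᵛ_ = zipWith _+_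

+ᵛ-commutativeMonoid : ℕ → CommutativeMonoid 0ℓ 0ℓ
+ᵛ-commutativeMonoid n = record
  { _∙_ = _+ᵛ_ {n}
  ; ε   = replicate n 0
  ; isCommutativeMonoid = record
    { isMonoid = record
      { isSemigroup = record
        { isMagma = record { isEquivalence = isEquivalence ; ∙-cong = cong₂ _+ᵛ_ }
        ; assoc   = zipWith-assoc +-assoc
        }
      ; identity = zipWith-identityˡ +-identityˡ , zipWith-identityʳ +-identityʳ
      }
    ; comm = zipWith-comm +-comm
    }
  }

-- `k` times the standard basis vector at `m`, the value of `k` copies of `r m`.
pulse : ∀ {n} → Fin n → ℕ → Vec ℕ n
pulse m k = updateAt (replicate _ 0) m (k +_)

pulse-+ᵛ : ∀ {n} m k (c : Vec ℕ n) → pulse m k +ᵛ c ≡ updateAt c m (k +_)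
pulse-+ᵛ zero k (x ∷ c) =
  cong₂ _∷_ (cong (_+ x) (+-identityʳ k)) (zipWith-identityˡ +-identityˡ c)
pulse-+ᵛ (suc m) k (x ∷ c) = cong (x ∷_) (pulse-+ᵛ m k c)

pulse-suc : ∀ {n} (m : Fin n) k → pulse m k +ᵛ pulse m 1 ≡ pulse m (suc k)
pulse-suc m k = trans (pulse-+ᵛ m k (pulse m 1))
  (trans (updateAt-updateAt m _) (updateAt-cong m (+-suc k) _))

-- One step of the fold that builds `start`, seen on counter vectors.
raise : ∀ {n} → Vec ℕ n → Vec ℕ n → Fin n → Vec ℕ n
raise k c m = updateAt c m (lookup k m +_)

foldl-raise-suc : ∀ {n} x y (k c : Vec ℕ n) ms →
  foldl (raise (x ∷ k)) (y ∷ c) (map suc ms) ≡ y ∷ foldl (raise k) c ms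
foldl-raise-suc x y k c []       = refl
foldl-raise-suc x y k c (m ∷ ms) = foldl-raise-suc x y k (raise k c m) ms

foldl-raise : ∀ {n} (k c : Vec ℕ n) → foldl (raise k) c (allFin n) ≡ k +ᵛ c
foldl-raise []      []      = refl
foldl-raise (x ∷ k) (y ∷ c) = begin
  -- The visit to `zero` has already been computed, turning `y` into `x + y`; the remaining indices
  -- are all successors.
  foldl (raise (x ∷ k)) (x + y ∷ c) (tabulate suc)
    ≡⟨ cong (foldl (raise (x ∷ k)) (x + y ∷ c)) (map-tabulate (λ i → i) suc) ⟨
  foldl (raise (x ∷ k)) (x + y ∷ c) (map suc (allFin _))
    ≡⟨ foldl-raise-suc x (x + y) k c (allFin _) ⟩
  x + y ∷ foldl (raise k) c (allFin _)
    ≡⟨ cong (x + y ∷_) (foldl-raise k c) ⟩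
  x + y ∷ k +ᵛ c
    ∎
  where open ≡-Reasoning

-- Encoding of machines

data Token (n : ℕ) : Set where
  at   : Label → Token n
  test : Fin n → Token n

module MachineModel {n : ℕ} (M : Machine n) {A : Set}
  (ν : Literal n → A) (ν-injective : Injective _≡_ _≡_ ν) where

  open Encoding ν

  𝑴 : CommutativeMonoid 0ℓ 0ℓ
  𝑴 = DirectProduct.commutativeMonoid
    (AtMostOne-commutativeMonoid (Token n)) (+ᵛ-commutativeMonoid n)

  open CommutativeMonoid 𝑴 using (Carrier; _≈_; _∙_; ε; comm; identityˡ; identityʳ)
    renaming (sym to ≈-sym)

  Pole : Pred Carrier 0ℓ
  Pole (none         , _) = Empty
  Pole (one (at i)   , c) = CanGo M (i , c) halting
  -- The other counters are unconstrained, since `κ m` can absorb them through `𝒦ₘ m`.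
  Pole (one (test m) , c) = lookup c m ≡ 0
  Pole (many         , _) = Empty

  resp : ∀ {x y} → x ≈ y → Pole x → Pole y
  resp (refl , refl) p = p

  ⌜_⌝ : Literal n → Carrier
  ⌜ `r m ⌝ = none , pulse m 1
  ⌜ `l i ⌝ = one (at i) , replicate n 0
  ⌜ `κ m ⌝ = one (test m) , replicate n 0

  -- Since `ν` is injective, `ν p` gets the singleton of `⌜ p ⌝`; atoms outside the image of `ν` get
  -- the empty set.
  valuation : A → Pred Carrier 0ℓ
  valuation a x = ∃[ p ] (ν p ≡ a × ⌜ p ⌝ ≡ x)

  open PhaseSemantics 𝑴 Pole resp valuation

  -- Literals in the model

  ⌜⌝∈⟦⟧ : ∀ p → ⟦ atom (ν p) ⟧ ⌜ p ⌝
  ⌜⌝∈⟦⟧ p t u = resp (comm ⌜ p ⌝ t) (u _ (p , refl , refl))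

  atom-refute : ∀ p {y} → Pole (⌜ p ⌝ ∙ y) → ⟦ atom (ν p) ⟧ᶜ y
  atom-refute p t _ (q , νq≡νp , refl) with refl ← ν-injective νq≡νp = t

  atom-refuted : ∀ p {y} → ⟦ atom (ν p) ⟧ᶜ y → Pole (⌜ p ⌝ ∙ y)
  atom-refuted p u = u _ (p , refl , refl)

  ⊗-refute : ∀ p q {y} → Pole ((⌜ p ⌝ ∙ ⌜ q ⌝) ∙ y) → ⟦ atom (ν p) ⊗ atom (ν q) ⟧ᶜ y
  ⊗-refute p q t = ⊙-ᗮᗮ λ { _ ((p′ , νp′≡νp , refl) , (q′ , νq′≡νq , refl)) →
    pole (ν-injective νp′≡νp) (ν-injective νq′≡νq) }
    where
    pole : ∀ {p′ q′} → p′ ≡ p → q′ ≡ q → Pole ((⌜ p′ ⌝ ∙ ⌜ q′ ⌝) ∙ _)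
    pole refl refl = t

  ⊗-refuted : ∀ p q {y} → ⟦ atom (ν p) ⊗ atom (ν q) ⟧ᶜ y → Pole ((⌜ p ⌝ ∙ ⌜ q ⌝) ∙ y)
  ⊗-refuted p q u = u _ (⌜⌝∈⟦⟧ p , ⌜⌝∈⟦⟧ q)

  -- A token in `y` would be a second one and put the product outside the pole, so only token-free
  -- `y` matters. Here `s` and `u` come from the conclusion of an implication, `t` and `v` from its
  -- premise.
  advance : ∀ {s t u v} {f g : Vec ℕ n → Vec ℕ n} →
            (∀ c → u +ᵛ c ≡ f c) → (∀ c → v +ᵛ c ≡ g c) →
            (∀ c → Pole (one s , f c) → Pole (one t , g c)) →
            ∀ y → Pole ((one s , u) ∙ y) → Pole ((one t , v) ∙ y)
  advance {s = s} {t} u≗f v≗g h (none , c) p =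
    resp {one t , _} (refl , sym (v≗g c)) (h c (resp {one s , _} (refl , u≗f c) p))
  advance _ _ _ (one _ , _) ()
  advance _ _ _ (many  , _) ()

  0+ : ∀ c → replicate n 0 +ᵛ c ≡ c
  0+ = zipWith-identityˡ +-identityˡ

  0+1+ : ∀ m c → (replicate n 0 +ᵛ pulse m 1) +ᵛ c ≡ updateAt c m suc
  0+1+ m c = trans (cong (_+ᵛ c) (0+ (pulse m 1))) (pulse-+ᵛ m 1 c)

  lookup-suc-pos : ∀ m (c : Vec ℕ n) → lookup (updateAt c m suc) m > 0
  lookup-suc-pos m c = subst (_> 0) (sym (lookup∘updateAt m c)) (s≤s z≤n)

  pred-suc : ∀ m (c : Vec ℕ n) → updateAt (updateAt c m suc) m pred ≡ c
  pred-suc m c = trans (updateAt-updateAt m c) (updateAt-id m c)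

  -- Truth of the instructions and the zero tests

  φ-affirm : ∀ {I} → I ∈ M → All (λ B → ⟦ B ⟧ ε) (φ I)
  φ-affirm {inc i m j} I∈M = ⊸-affirm (l i) (l j ⊗ r m)
    (λ {y} → atom-refute (`l i)
      ∘ advance (0+1+ m) 0+ (λ c → (_ , I∈M , inc) ◅_) y
      ∘ ⊗-refuted (`l j) (`r m)) ∷ []
  φ-affirm {dec i m j} I∈M = ⊸-affirm (l i ⊗ r m) (l j)
    (λ {y} → ⊗-refute (`l i) (`r m)
      ∘ advance 0+ (0+1+ m) step y
      ∘ atom-refuted (`l j)) ∷ []
    where
    step : ∀ c → CanGo M (j , c) halting → CanGo M (i , updateAt c m suc) halting
    -- The `r m` in the premise makes the counter a successor, which permits the decrement; undoing
    -- it gives back `c`.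
    step c p = (_ , I∈M , dec (lookup-suc-pos m c)) ◅
      subst (λ d → CanGo M (j , d) halting) (sym (pred-suc m c)) p
  φ-affirm {ifPos i m j} I∈M = ⊸-affirm (l i ⊗ r m) (l j ⊗ r m)
    (λ {y} → ⊗-refute (`l i) (`r m)
      ∘ advance (0+1+ m) (0+1+ m) (λ c → (_ , I∈M , ifPos (lookup-suc-pos m c)) ◅_) y
      ∘ ⊗-refuted (`l j) (`r m)) ∷ []
  -- Refuting a sum refutes both summands: `l j` supplies the rest of the run, and `κ m` supplies
  -- the zero condition that the instruction checks.
  φ-affirm {ifZero i m j} I∈M = ⊸-affirm (l i) (l j ⊕ κ m)
    (λ {y} u → atom-refute (`l i)
      (step y (u _ (inj₁ (⌜⌝∈⟦⟧ (`l j)))) (u _ (inj₂ (⌜⌝∈⟦⟧ (`κ m)))))) ∷ []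
    where
    step : ∀ y → Pole (⌜ `l j ⌝ ∙ y) → Pole (⌜ `κ m ⌝ ∙ y) → Pole (⌜ `l i ⌝ ∙ y)
    step (none  , _) p z = (_ , I∈M , ifZero z) ◅ p
    step (one _ , _) ()
    step (many  , _) ()
  φ-affirm {halt} _ = []

  -- Every instruction that can be applied has a nonzero label, so a run from label 0 is empty.
  stuck-at-0 : ∀ {c} → CanGo M (0 , c) halting → c ≡ replicate n 0
  stuck-at-0 Star.ε = refl
  stuck-at-0 ((_ , _ , inc {{()}}) ◅ _)
  stuck-at-0 ((_ , _ , dec {{()}} _) ◅ _)
  stuck-at-0 ((_ , _ , ifPos {{()}} _) ◅ _)
  stuck-at-0 ((_ , _ , ifZero {{()}} _) ◅ _)

  -- In the pole, label 0 forces all counters to be zero, in particular counter `m`. Draining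
  -- touches only counters other than `m`, so the zero test is unaffected.
  𝒦ₘ-affirm : ∀ m → All (λ B → ⟦ B ⟧ ε) (𝒦ₘ m)
  𝒦ₘ-affirm m =
    ⊸-affirm (κ m) (l 0)
      (λ {y} → atom-refute (`κ m) ∘ advance 0+ 0+ empty y ∘ atom-refuted (`l 0)) ∷
    All.map⁺ (All.map drain (All.all-filter (λ i → ¬? (i ≟ m)) (allFin n)))
    where
    empty : ∀ c → CanGo M (0 , c) halting → lookup c m ≡ 0
    empty c p = trans (cong (λ d → lookup d m) (stuck-at-0 p)) (lookup-replicate m 0)

    drain : ∀ {i} → i ≢ m → ⟦ (κ m ⊗ r i) ⊸ κ m ⟧ ε
    drain {i} i≢m = ⊸-affirm (κ m ⊗ r i) (κ m)
      (λ {y} → ⊗-refute (`κ m) (`r i)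
        ∘ advance 0+ (0+1+ i) (λ c → trans (lookup∘updateAt′ m i (i≢m ∘ sym) c)) y
        ∘ atom-refuted (`κ m))

  Φ++𝒦-affirm : All (λ B → ⟦ B ⟧ ε) (Φ M ++ 𝒦)
  Φ++𝒦-affirm = All.++⁺
    (All.concat⁺ (All.map⁺ (All.tabulate φ-affirm)))
    (All.concat⁺ (All.map⁺ (All.universal 𝒦ₘ-affirm (allFin n))))

  -- The start formula and the conclusion

  pow⁺-affirm : ∀ m k → ⟦ pow⁺ (r m) k ⟧ (none , pulse m (suc k))
  pow⁺-affirm m zero    = ⌜⌝∈⟦⟧ (`r m)
  pow⁺-affirm m (suc k) = ⟦⟧-resp (pow⁺ (r m) (suc k)) (refl , pulse-suc m (suc k))
    (⊗-affirm (pow⁺ (r m) k) (r m) (pow⁺-affirm m k) (⌜⌝∈⟦⟧ (`r m)))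

  ⊗^-affirm : ∀ C m k {i c} → ⟦ C ⟧ (one (at i) , c) →
              ⟦ C ⊗[ r m ^ k ] ⟧ (one (at i) , updateAt c m (k +_))
  ⊗^-affirm C m zero    p = ⟦⟧-resp C (refl , sym (updateAt-id m _)) p
  ⊗^-affirm C m (suc k) {c = c} p = ⟦⟧-resp (C ⊗ pow⁺ (r m) k)
    (refl , trans (zipWith-comm +-comm c _) (pulse-+ᵛ m (suc k) c))
    (⊗-affirm C (pow⁺ (r m) k) p (pow⁺-affirm m k))

  foldl-affirm : ∀ k C ms {i c} → ⟦ C ⟧ (one (at i) , c) →
    ⟦ foldl (λ C m → C ⊗[ r m ^ lookup k m ]) C ms ⟧ (one (at i) , foldl (raise k) c ms)
  foldl-affirm k C []       p = p
  foldl-affirm k C (m ∷ ms) p = foldl-affirm k _ ms (⊗^-affirm C m (lookup k m) p)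

  start-affirm : ∀ k → ⟦ start k ⟧ (one (at 1) , k)
  start-affirm k = ⟦⟧-resp (start k)
    (refl , trans (foldl-raise k (replicate n 0)) (zipWith-identityʳ +-identityʳ k))
    (foldl-affirm k (l 1) (allFin n) (⌜⌝∈⟦⟧ (`l 1)))

  ⟦l0⟧⊆Pole : ⟦ l 0 ⟧ ⊆ Pole
  ⟦l0⟧⊆Pole {x} b = resp (identityˡ x)
    (b ε (atom-refute (`l 0) (resp (≈-sym (identityʳ ⌜ `l 0 ⌝)) Star.ε)))

theorem3 : ∀ (n : ℕ) (M : Machine n) (k : Vec ℕ n)
    (A : Set) (ν : Literal n → A) → Injective _≡_ _≡_ ν →
    let open Encoding ν in
    start k ∷ map !_ (Φ M) ++ map !_ 𝒦 ⊢ [ l 0 ] →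
    CanGo M (initial k) halting
-- At this element the pole is by definition the reachability claim.
theorem3 n M k A ν ν-injective d = ⟦l0⟧⊆Pole {one (at 1) , k}
  (⊢⇒⟦⟧-⊆ Φ++𝒦-affirm
    (subst (λ Γ → start k ∷ Γ ⊢ [ l 0 ]) (sym (map-++ !_ (Φ M) 𝒦)) d)
    (start-affirm k))
  where
  open Encoding ν
  open MachineModel M ν ν-injective
  open PhaseSemantics 𝑴 Pole resp valuation using (⊢⇒⟦⟧-⊆)
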